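{- Let $A_1,A_2$ be the $6\times6$ matrices over $\mathbb{R}_{\max}$ whose only entries different from $\varepsilon=-\infty$ are the following. For both $s=1,2$: $(A_s)_{1,2}=(A_s)_{2,3}=(A_s)_{3,4}=(A_s)_{4,1}=0$ and $(A_s)_{5,6}=-100$; moreover $(A_1)_{3,5}=(A_1)_{6,4}=-100$ and $(A_2)_{3,5}=(A_2)_{6,4}=-1$. (Their common associated digraph has cyclicity $2$, and their common critical digraph is the cycle $1\to2\to3\to4\to1$, of cyclicity $4$.) Then for every $t\ge2$ none of the products $(A_1)^{4t}\otimes A_2$, $(A_1)^{4t+1}\otimes A_2$, $(A_1)^{4t+2}\otimes A_2$, $(A_1)^{4t+3}\otimes A_2$ is CSR. Consequently, there are arbitrarily long products of matrices from $\{A_1,A_2\}$ that are not CSR.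
   Context: $\mathbb{R}_{\max}=\mathbb{R}\cup\{ -\infty\}$ with $a\oplus b=\max(a,b)$, $a\otimes b=a+b$; $(A\otimes B)_{i,j}=\max_l(a_{i,l}+b_{l,j})$; matrix powers are tropical and $A^0=I$ ($0$ on the diagonal, $\varepsilon$ elsewhere). The digraph associated with a square matrix $A$ has an edge $(i,j)$ of weight $a_{i,j}$ iff $a_{i,j}\ne\varepsilon$. The critical digraph of $A$ consists of all nodes and edges on cycles whose mean weight (weight/length) is maximal. The cyclicity of a strongly connected digraph is the gcd of its cycle lengths. CSR: let $\mathcal{E}_c$ be the edge set of the common critical digraph of the matrices in the set, $\gamma$ its cyclicity, $S$ the matrix with $S_{i,j}=0$ for $(i,j)\in\mathcal{E}_c$ and $\varepsilon$ otherwise, $T(S)$ the least $T$ with $S^{l+\gamma}=S^l$ for all $l\ge T$, and $t_0$ any integer with $t_0\gamma\ge T(S)$. For a product $\Gamma(k)$ of $k$ matrices from the set, and $k\,(\mathrm{mod}\,\gamma)\in\{0,\dots,\gamma-1\}$, put $C=\Gamma(k)\otimes S^{(t_0+1)\gamma-k(\mathrm{mod}\,\gamma)}$ and $R=S^{(t_0+1)\gamma-k(\mathrm{mod}\,\gamma)}\otimes\Gamma(k)$. $\Gamma(k)$ is called CSR if $\Gamma(k)=C\otimes S^{k(\mathrm{mod}\,\gamma)}\otimes R$. -}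

module Defs where

open import Data.Fin.Base using (Fin)
open import Data.Fin.Patterns using (0F; 1F; 2F; 3F; 4F; 5F)
open import Data.Fin.Properties using (_≟_)
open import Data.Integer.Base as ℤ using (ℤ; +_)
open import Data.List.Base using (List; []; _∷_; map; length)
open import Data.List.Membership.Propositional using (_∈_)
open import Data.List.Relation.Unary.Unique.Propositional using (Unique)
open import Data.Nat.Base as ℕ using (ℕ; zero; suc; NonZero; _∸_)
open import Data.Nat.Coprimality using (1-coprimeTo)
open import Data.Nat.Divisibility using (_∣_)
open import Data.Nat.DivMod using (_%_)
import Data.Nat.Properties as ℕ
open import Data.Product.Base using (∃-syntax; _×_; _,_; proj₁; proj₂)
open import Data.Rational.Base as ℚ using (ℚ; 0ℚ; 1ℚ; ½; *≤*; _/_)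
import Data.Rational.Properties as ℚ
open import Algebra.Properties.Group ℚ.+-0-group using (⁻¹-involutive)
open import Data.Sum.Base using (inj₁; inj₂)
open import Data.Vec.Base using (Vec; []; _∷_)
open import Data.Vec.Functional using (foldr)
open import Level using (0ℓ)
open import Relation.Binary.Construct.Closure.ReflexiveTransitive using (Star; ε; _◅_)
import Relation.Binary.Construct.Add.Infimum.Equality as AddInfimum
open import Relation.Binary.Core using (Rel; _⇔_)
open import Relation.Binary.PropositionalEquality
open import Relation.Nullary.Construct.Add.Infimum using (_₋; ⊥₋; [_])
open import Relation.Nullary.Decidable using (yes; no)
open import Relation.Nullary.Negation using (¬_; contradiction)
open import Relation.Unary using (Pred; U; _≐_)

IsCauchy : (ℕ → ℚ) → Set
IsCauchy x = ∀ e → 0ℚ ℚ.< e →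
  ∃[ N ] ∀ m n → N ℕ.≤ m → N ℕ.≤ n → ℚ.∣ x m ℚ.- x n ∣ ℚ.< e

record ℝ : Set where
  constructor mkℝ
  field
    seq    : ℕ → ℚ
    cauchy : IsCauchy seq

open ℝ public

infix 4 _≃_ _≤_

_≃_ : Rel ℝ 0ℓ
x ≃ y = ∀ e → 0ℚ ℚ.< e →
  ∃[ N ] ∀ n → N ℕ.≤ n → ℚ.∣ seq x n ℚ.- seq y n ∣ ℚ.< e

_≤_ : Rel ℝ 0ℓ
x ≤ y = ∀ e → 0ℚ ℚ.< e →
  ∃[ N ] ∀ n → N ℕ.≤ n → seq x n ℚ.< seq y n ℚ.+ e

private
  p-q+q≡p : ∀ p q → (p ℚ.- q) ℚ.+ q ≡ p
  p-q+q≡p p q = begin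
    (p ℚ.- q) ℚ.+ q       ≡⟨ ℚ.+-assoc p (ℚ.- q) q ⟩
    p ℚ.+ (ℚ.- q ℚ.+ q)   ≡⟨ cong (p ℚ.+_) (ℚ.+-inverseˡ q) ⟩
    p ℚ.+ 0ℚ              ≡⟨ ℚ.+-identityʳ p ⟩
    p                     ∎
    where open ≡-Reasoning

  q+p-q≡p : ∀ p q → (q ℚ.+ p) ℚ.- q ≡ p
  q+p-q≡p p q = begin
    (q ℚ.+ p) ℚ.- q       ≡⟨ cong (ℚ._- q) (ℚ.+-comm q p) ⟩
    (p ℚ.+ q) ℚ.- q       ≡⟨ ℚ.+-assoc p q (ℚ.- q) ⟩
    p ℚ.+ (q ℚ.- q)       ≡⟨ cong (p ℚ.+_) (ℚ.+-inverseʳ q) ⟩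
    p ℚ.+ 0ℚ              ≡⟨ ℚ.+-identityʳ p ⟩
    p                     ∎
    where open ≡-Reasoning

  neg-minus : ∀ p q → ℚ.- (p ℚ.- q) ≡ q ℚ.- p
  neg-minus p q = begin
    ℚ.- (p ℚ.- q)          ≡⟨ ℚ.neg-distrib-+ p (ℚ.- q) ⟩
    ℚ.- p ℚ.+ ℚ.- (ℚ.- q)  ≡⟨ cong (ℚ.- p ℚ.+_) (⁻¹-involutive q) ⟩
    ℚ.- p ℚ.+ q            ≡⟨ ℚ.+-comm (ℚ.- p) q ⟩
    q ℚ.- p                ∎
    where open ≡-Reasoning

  ∣-∣-sym : ∀ p q → ℚ.∣ p ℚ.- q ∣ ≡ ℚ.∣ q ℚ.- p ∣
  ∣-∣-sym p q = trans (sym (ℚ.∣-p∣≡∣p∣ (p ℚ.- q))) (cong ℚ.∣_∣ (neg-minus p q))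

  p≤∣p∣ : ∀ p → p ℚ.≤ ℚ.∣ p ∣
  p≤∣p∣ p with ℚ.≤-total 0ℚ p
  ... | inj₁ 0≤p = ℚ.≤-reflexive (sym (ℚ.0≤p⇒∣p∣≡p 0≤p))
  ... | inj₂ p≤0 = ℚ.≤-trans p≤0 (ℚ.0≤∣p∣ p)

  near⇒< : ∀ {p q e} → ℚ.∣ p ℚ.- q ∣ ℚ.< e → p ℚ.< q ℚ.+ e
  near⇒< {p} {q} {e} h = subst₂ ℚ._<_ (p-q+q≡p p q) (ℚ.+-comm e q)
    (ℚ.+-monoˡ-< q (ℚ.≤-<-trans (p≤∣p∣ (p ℚ.- q)) h))

  <⇒-< : ∀ {p q e} → p ℚ.< q ℚ.+ e → p ℚ.- q ℚ.< e
  <⇒-< {p} {q} {e} h = subst (p ℚ.- q ℚ.<_) (q+p-q≡p e q) (ℚ.+-monoˡ-< (ℚ.- q) h)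

  <⇒near : ∀ {p q e} → p ℚ.< q ℚ.+ e → q ℚ.< p ℚ.+ e → ℚ.∣ p ℚ.- q ∣ ℚ.< e
  <⇒near {p} {q} {e} h k with ℚ.∣p∣≡p∨∣p∣≡-p (p ℚ.- q)
  ... | inj₁ eq = subst (ℚ._< e) (sym eq) (<⇒-< h)
  ... | inj₂ eq = subst (ℚ._< e) (sym (trans eq (neg-minus p q))) (<⇒-< k)

  ⊔-< : ∀ {a b c d e} → a ℚ.< c ℚ.+ e → b ℚ.< d ℚ.+ e → a ℚ.⊔ b ℚ.< (c ℚ.⊔ d) ℚ.+ e
  ⊔-< {a} {b} {c} {d} {e} h k with ℚ.⊔-sel a b
  ... | inj₁ eq = subst (ℚ._< _) (sym eq)
                    (ℚ.<-≤-trans h (ℚ.+-monoˡ-≤ e (ℚ.p≤p⊔q c d)))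
  ... | inj₂ eq = subst (ℚ._< _) (sym eq)
                    (ℚ.<-≤-trans k (ℚ.+-monoˡ-≤ e (ℚ.p≤q⊔p c d)))

  ⊔-near : ∀ {a b c d e} → ℚ.∣ a ℚ.- c ∣ ℚ.< e → ℚ.∣ b ℚ.- d ∣ ℚ.< e →
           ℚ.∣ (a ℚ.⊔ b) ℚ.- (c ℚ.⊔ d) ∣ ℚ.< e
  ⊔-near {a} {b} {c} {d} {e} h k = <⇒near
    (⊔-< {a} {b} {c} {d} (near⇒< {a} {c} h) (near⇒< {b} {d} k))
    (⊔-< {c} {d} {a} {b} (near⇒< {c} {a} (subst (ℚ._< e) (∣-∣-sym a c) h))
                         (near⇒< {d} {b} (subst (ℚ._< e) (∣-∣-sym b d) k)))

  half+half : ∀ e → (½ ℚ.* e) ℚ.+ (½ ℚ.* e) ≡ e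
  half+half e = trans (sym (ℚ.*-distribʳ-+ e ½ ½)) (ℚ.*-identityˡ e)

  half-pos : ∀ {e} → 0ℚ ℚ.< e → 0ℚ ℚ.< ½ ℚ.* e
  half-pos {e} 0<e = subst (ℚ._< ½ ℚ.* e) (ℚ.*-zeroʳ ½) (ℚ.*-monoʳ-<-pos ½ 0<e)

  +-< : ∀ {a b c d e} → a ℚ.< c ℚ.+ ½ ℚ.* e → b ℚ.< d ℚ.+ ½ ℚ.* e →
        a ℚ.+ b ℚ.< (c ℚ.+ d) ℚ.+ e
  +-< {a} {b} {c} {d} {e} h k = subst (a ℚ.+ b ℚ.<_) eq (ℚ.+-mono-< h k)
    where
    open ≡-Reasoning
    f = ½ ℚ.* e
    eq : (c ℚ.+ f) ℚ.+ (d ℚ.+ f) ≡ (c ℚ.+ d) ℚ.+ e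
    eq = begin
      (c ℚ.+ f) ℚ.+ (d ℚ.+ f)  ≡⟨ ℚ.+-assoc c f (d ℚ.+ f) ⟩
      c ℚ.+ (f ℚ.+ (d ℚ.+ f))  ≡⟨ cong (c ℚ.+_) (ℚ.+-comm f (d ℚ.+ f)) ⟩
      c ℚ.+ ((d ℚ.+ f) ℚ.+ f)  ≡⟨ cong (c ℚ.+_) (ℚ.+-assoc d f f) ⟩
      c ℚ.+ (d ℚ.+ (f ℚ.+ f))  ≡⟨ cong (λ z → c ℚ.+ (d ℚ.+ z)) (half+half e) ⟩
      c ℚ.+ (d ℚ.+ e)          ≡⟨ ℚ.+-assoc c d e ⟨
      (c ℚ.+ d) ℚ.+ e          ∎

  +-near : ∀ {a b c d e} → ℚ.∣ a ℚ.- c ∣ ℚ.< ½ ℚ.* e → ℚ.∣ b ℚ.- d ∣ ℚ.< ½ ℚ.* e →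
           ℚ.∣ (a ℚ.+ b) ℚ.- (c ℚ.+ d) ∣ ℚ.< e
  +-near {a} {b} {c} {d} {e} h k = <⇒near
    (+-< {a} {b} {c} {d} (near⇒< {a} {c} h) (near⇒< {b} {d} k))
    (+-< {c} {d} {a} {b} (near⇒< {c} {a} (subst (ℚ._< ½ ℚ.* e) (∣-∣-sym a c) h))
                         (near⇒< {d} {b} (subst (ℚ._< ½ ℚ.* e) (∣-∣-sym b d) k)))

  ÷-near : ∀ {p q e} n .{{_ : NonZero n}} → ℚ.∣ p ℚ.- q ∣ ℚ.< e →
           ℚ.∣ (p ℚ.* (+ 1 / n)) ℚ.- (q ℚ.* (+ 1 / n)) ∣ ℚ.< e
  ÷-near {p} {q} {e} n@(suc m) h = ℚ.≤-<-trans (begin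
    ℚ.∣ (p ℚ.* r) ℚ.- (q ℚ.* r) ∣    ≡⟨ cong (λ z → ℚ.∣ p ℚ.* r ℚ.+ z ∣) (ℚ.neg-distribˡ-* q r) ⟩
    ℚ.∣ p ℚ.* r ℚ.+ (ℚ.- q) ℚ.* r ∣  ≡⟨ cong ℚ.∣_∣ (ℚ.*-distribʳ-+ r p (ℚ.- q)) ⟨
    ℚ.∣ (p ℚ.- q) ℚ.* r ∣            ≡⟨ ℚ.∣p*q∣≡∣p∣*∣q∣ (p ℚ.- q) r ⟩
    ℚ.∣ p ℚ.- q ∣ ℚ.* ℚ.∣ r ∣        ≤⟨ ℚ.*-monoˡ-≤-nonNeg ℚ.∣ p ℚ.- q ∣ {{ℚ.∣-∣-nonNeg (p ℚ.- q)}} ∣r∣≤1 ⟩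
    ℚ.∣ p ℚ.- q ∣ ℚ.* 1ℚ             ≡⟨ ℚ.*-identityʳ _ ⟩
    ℚ.∣ p ℚ.- q ∣                    ∎) h
    where
    open ℚ.≤-Reasoning
    r = + 1 / n
    ∣r∣≤1 : ℚ.∣ r ∣ ℚ.≤ 1ℚ
    ∣r∣≤1 rewrite ℚ.normalize-coprime {1} {m} (1-coprimeTo n) =
      *≤* (ℤ.+≤+ (ℕ.s≤s ℕ.z≤n))

fromℚ : ℚ → ℝ
fromℚ q = mkℝ (λ _ → q) λ e 0<e →
  0 , λ _ _ _ _ → subst (ℚ._< e) (sym (cong ℚ.∣_∣ (ℚ.+-inverseʳ q))) 0<e

fromℤ : ℤ → ℝ
fromℤ i = fromℚ (i / 1)

infixl 6 _+_ _⊔_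
infixl 7 _÷_

_+_ : ℝ → ℝ → ℝ
x + y = mkℝ (λ n → seq x n ℚ.+ seq y n) λ e 0<e →
  let M , f = cauchy x (½ ℚ.* e) (half-pos 0<e)
      N , g = cauchy y (½ ℚ.* e) (half-pos 0<e)
  in M ℕ.⊔ N , λ m n p q → +-near {seq x m} {seq y m} {seq x n} {seq y n}
       (f m n (ℕ.m⊔n≤o⇒m≤o M N p) (ℕ.m⊔n≤o⇒m≤o M N q))
       (g m n (ℕ.m⊔n≤o⇒n≤o M N p) (ℕ.m⊔n≤o⇒n≤o M N q))

_⊔_ : ℝ → ℝ → ℝ
x ⊔ y = mkℝ (λ n → seq x n ℚ.⊔ seq y n) λ e 0<e →
  let M , f = cauchy x e 0<e
      N , g = cauchy y e 0<e
  in M ℕ.⊔ N , λ m n p q → ⊔-near {seq x m} {seq y m} {seq x n} {seq y n}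
       (f m n (ℕ.m⊔n≤o⇒m≤o M N p) (ℕ.m⊔n≤o⇒m≤o M N q))
       (g m n (ℕ.m⊔n≤o⇒n≤o M N p) (ℕ.m⊔n≤o⇒n≤o M N q))

_÷_ : ℝ → (k : ℕ) .{{_ : NonZero k}} → ℝ
x ÷ k = mkℝ (λ n → seq x n ℚ.* (+ 1 / k)) λ e 0<e →
  let N , f = cauchy x e 0<e
  in N , λ m n p q → ÷-near {seq x m} {seq x n} k (f m n p q)

-- ⊥₋ is the element written ε = -∞.
ℝmax : Set
ℝmax = ℝ ₋

open AddInfimum _≃_ public using (_≈₋_; ⊥₋≈⊥₋; [_])

infixl 6 _⊕_
infixl 7 _⊙_

_⊕_ : ℝmax → ℝmax → ℝmax
⊥₋    ⊕ b     = b
[ x ] ⊕ ⊥₋    = [ x ]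
[ x ] ⊕ [ y ] = [ x ⊔ y ]

_⊙_ : ℝmax → ℝmax → ℝmax
[ x ] ⊙ [ y ] = [ x + y ]
[ _ ] ⊙ ⊥₋    = ⊥₋
⊥₋    ⊙ _     = ⊥₋

𝟘 : ℝmax
𝟘 = [ fromℤ (+ 0) ]

Matrix : ℕ → Set
Matrix n = Fin n → Fin n → ℝmax

infix  4 _≈_
infixl 7 _⊗_
infixr 8 _^_

_≈_ : ∀ {n} → Rel (Matrix n) 0ℓ
A ≈ B = ∀ i j → A i j ≈₋ B i j

_⊗_ : ∀ {n} → Matrix n → Matrix n → Matrix n
(A ⊗ B) i j = foldr _⊕_ ⊥₋ λ l → A i l ⊙ B l j

I : ∀ {n} → Matrix n
I i j with i ≟ j
... | yes _ = 𝟘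
... | no  _ = ⊥₋

_^_ : ∀ {n} → Matrix n → ℕ → Matrix n
A ^ zero  = I
A ^ suc k = A ⊗ A ^ k

∏ : ∀ {n k} {Ix : Set} → (Ix → Matrix n) → Vec Ix k → Matrix n
∏ A []      = I
∏ A (s ∷ w) = A s ⊗ ∏ A w

record Digraph (n : ℕ) : Set₁ where
  field
    Node : Pred (Fin n) 0ℓ
    Edge : Rel (Fin n) 0ℓ

open Digraph public

infix 4 _≋_

_≋_ : ∀ {n} → Digraph n → Digraph n → Set
D ≋ E = (Node D ≐ Node E) × (Edge D ⇔ Edge E)

edges : ∀ {n} {E : Rel (Fin n) 0ℓ} {i j} → Star E i j → List (Fin n × Fin n)
edges ε                 = []
edges (_◅_ {i} {j} _ w) = (i , j) ∷ edges w

-- A closed walk of positive length with no repeated node, apart from the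
-- coincidence of its two ends.
record Cycle {n} (D : Digraph n) : Set where
  field
    base : Fin n
    walk : Star (Edge D) base base

  nodes : List (Fin n)
  nodes = map proj₁ (edges walk)

  len : ℕ
  len = length (edges walk)

  field
    {{len≢0}} : NonZero len
    simple    : Unique nodes

open Cycle public

StronglyConnected : ∀ {n} → Digraph n → Set
StronglyConnected D = ∀ i j → Node D i → Node D j → Star (Edge D) i j

record HasCyclicity {n} (D : Digraph n) (γ : ℕ) : Set where
  field
    connected : StronglyConnected D
    divides   : (c : Cycle D) → γ ∣ len c
    greatest  : ∀ d → ((c : Cycle D) → d ∣ len c) → d ∣ γ

digraph : ∀ {n} → Matrix n → Digraph n
digraph A = record { Node = U ; Edge = λ i j → A i j ≢ ⊥₋ }

finite : (a : ℝmax) → a ≢ ⊥₋ → ℝ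
finite ⊥₋    a≢⊥ = contradiction refl a≢⊥
finite [ x ] _   = x

weight : ∀ {n} (A : Matrix n) {i j} → Star (Edge (digraph A)) i j → ℝ
weight A ε                 = fromℤ (+ 0)
weight A (_◅_ {i} {j} e w) = finite (A i j) e + weight A w

mean : ∀ {n} (A : Matrix n) → Cycle (digraph A) → ℝ
mean A c = weight A (walk c) ÷ len c

Critical : ∀ {n} (A : Matrix n) → Cycle (digraph A) → Set
Critical A c = ∀ c′ → mean A c′ ≤ mean A c

criticalDigraph : ∀ {n} → Matrix n → Digraph n
criticalDigraph A = record
  { Node = λ i   → ∃[ c ] Critical A c × i ∈ nodes c
  ; Edge = λ i j → ∃[ c ] Critical A c × (i , j) ∈ edges (walk c)
  }

Periodic : ∀ {n} → Matrix n → (γ T : ℕ) → Set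
Periodic S γ T = ∀ l → T ℕ.≤ l → S ^ (l ℕ.+ γ) ≈ S ^ l

record CSRData {n} {Ix : Set} (A : Ix → Matrix n) : Set₁ where
  field
    critical   : Digraph n
    common     : ∀ s → criticalDigraph (A s) ≋ critical

    γ          : ℕ
    {{γ≢0}}    : NonZero γ
    cyclicity  : HasCyclicity critical γ

    S          : Matrix n
    S-edge     : ∀ i j → Edge critical i j → S i j ≈₋ 𝟘
    S-nonEdge  : ∀ i j → ¬ Edge critical i j → S i j ≈₋ ⊥₋

    T          : ℕ
    periodic   : Periodic S γ T
    least      : ∀ T′ → Periodic S γ T′ → T ℕ.≤ T′

    -- T ≥ 0 and γ > 0 force t₀ ≥ 0, so an integer t₀ is a natural number.
    t₀         : ℕ
    T≤t₀γ      : T ℕ.≤ t₀ ℕ.* γ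

-- The subtraction does not truncate, as k % γ < γ.
IsCSR : ∀ {n} {Ix : Set} {A : Ix → Matrix n} → CSRData A → ℕ → Matrix n → Set
IsCSR d k Γ = Γ ≈ C ⊗ S ^ (k % γ) ⊗ R
  where
  open CSRData d
  p = (t₀ ℕ.+ 1) ℕ.* γ ∸ k % γ
  C = Γ ⊗ S ^ p
  R = S ^ p ⊗ Γ

-- The entry (i , j), numbered from 1, has indices i - 1 and j - 1 here;
-- x is the common value of the entries (3 , 5) and (6 , 4).
example : ℤ → Matrix 6
example x 0F 1F = 𝟘
example x 1F 2F = 𝟘
example x 2F 3F = 𝟘
example x 3F 0F = 𝟘
example x 4F 5F = [ fromℤ (ℤ.- + 100) ]
example x 2F 4F = [ fromℤ x ]
example x 5F 3F = [ fromℤ x ]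
example x _  _  = ⊥₋

A₁ A₂ : Matrix 6
A₁ = example (ℤ.- + 100)
A₂ = example (ℤ.- + 1)

A₁,₂ : Fin 2 → Matrix 6
A₁,₂ 0F = A₁
A₁,₂ 1F = A₂

data C₄-Node : Pred (Fin 6) 0ℓ where
  n₁ : C₄-Node 0F
  n₂ : C₄-Node 1F
  n₃ : C₄-Node 2F
  n₄ : C₄-Node 3F

data C₄-Edge : Rel (Fin 6) 0ℓ where
  e₁₂ : C₄-Edge 0F 1F
  e₂₃ : C₄-Edge 1F 2F
  e₃₄ : C₄-Edge 2F 3F
  e₄₁ : C₄-Edge 3F 0F

C₄ : Digraph 6
C₄ = record { Node = C₄-Node ; Edge = C₄-Edge }

{-# OPTIONS --safe #-}

-- A detour 3 → 5 → 6 → 4 replaces one edge of the critical cycle by three, so it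
-- shifts the position reached on that cycle by 2 modulo 4; it costs 300 with A₁
-- alone, but only 201 if its last edge is taken from A₂.  Let Γ end in a single
-- factor A₂, and let i be the row from which walks of length k - 1 on the critical
-- cycle end at 1.  A walk of length k from i to 5 leaves the cycle at 3 with its
-- last edge, so it must have made a whole detour with A₁ before, and
-- Γ(i , 5) ≤ -301.  In the product C ⊗ S^(k mod γ) ⊗ R the first copy of Γ may
-- end with the cheap detour to 4 and the second one may then go to 5 directly,
-- which gives at least -201 - 1 = -202.
module Submission where

open import Algebra.Bundles using (module CommutativeMonoid)
open import Algebra.Properties.CommutativeSemigroup using (interchange)
open import Data.Bool.Base using (if_then_else_)
open import Data.Fin.Base using (Fin; toℕ)
open import Data.Fin.Patterns using (0F; 1F; 2F; 3F; 4F; 5F)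
open import Data.Fin.Properties using (_≟_; all?)
open import Data.Integer.Base as ℤ using (ℤ; +_)
open import Data.List.Base as List using ([]; _∷_; length)
open import Data.List.Membership.Propositional using (_∈_)
open import Data.List.Membership.Propositional.Properties using (∈-map⁺; ∈-map⁻)
open import Data.List.Relation.Unary.Any using (here; there)
open import Data.List.Relation.Unary.Unique.DecPropositional (_≟_ {6}) using (unique?)
open import Data.List.Relation.Unary.Unique.Propositional using (Unique)
open import Data.Maybe.Base as Maybe using (Maybe)
import Data.Maybe.Properties as Maybe
open import Data.Nat.Base as ℕ using (ℕ; zero; suc; NonZero; _≤_; _+_; _*_)
open import Data.Nat.Coprimality using (1-coprimeTo)
open import Data.Nat.Divisibility using (_∣_; divides; divides-refl; ∣m+n∣m⇒∣n; ∣n⇒∣m*n)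
open import Data.Nat.DivMod using (_%_; m%n<n; m≡m%n+[m/n]*n)
open import Data.Nat.GeneralisedArithmetic using (fold; fold-+)
import Data.Nat.Properties as ℕ
open import Data.Nat.Solver using (module +-*-Solver)
open import Data.Product.Base using (_×_; _,_; ∃-syntax; Σ-syntax; proj₁; proj₂)
open import Data.Product.Properties using (≡-dec)
open import Data.List.Membership.DecPropositional (≡-dec (_≟_ {6}) (_≟_ {6})) using (_∈?_)
open import Data.Rational.Base as ℚ using (ℚ; 0ℚ; 1ℚ; ½; _/_)
import Data.Rational.Properties as ℚ
open import Algebra.Properties.AbelianGroup ℚ.+-0-abelianGroup
  using (//-rightDividesˡ; //-rightDividesʳ; ⁻¹-anti-homo-//)
open import Data.Sum.Base using (_⊎_; inj₁; inj₂)
open import Data.Vec.Base using (Vec; []; _∷_; _++_; replicate)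
open import Data.Vec.Functional using (foldr)
open import Level using (0ℓ)
open import Relation.Binary.Construct.Closure.ReflexiveTransitive as Star using (Star; ε; _◅_; _◅◅_)
open import Relation.Binary.Core using (Rel; _⇒_)
open import Relation.Binary.PropositionalEquality
open import Relation.Nullary.Construct.Add.Infimum using (⊥₋; [_])
open import Relation.Nullary.Decidable
  using (Dec; yes; no; does; True; toWitness; from-yes; from-no; map′; dec-true; dec-false;
         _→-dec_; _⊎-dec_; ¬?)
open import Relation.Nullary.Negation using (¬_; contradiction)
open import Defs hiding (_≤_; _+_)
open import Defs using () renaming (_≤_ to _≤ᵣ_; _+_ to _+ᵣ_)
open import Relation.Binary.Construct.Add.Infimum.NonStrict _≤ᵣ_
  using (_≤₋_; ⊥₋≤_; [_]; [≤]-injective; ≤₋-trans)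

-- The order on ℝ

half-pos : ∀ {e} → 0ℚ ℚ.< e → 0ℚ ℚ.< ½ ℚ.* e
half-pos {e} 0<e = subst (ℚ._< ½ ℚ.* e) (ℚ.*-zeroʳ ½) (ℚ.*-monoʳ-<-pos ½ 0<e)

half+half : ∀ e → ½ ℚ.* e ℚ.+ ½ ℚ.* e ≡ e
half+half e = trans (sym (ℚ.*-distribʳ-+ e ½ ½)) (ℚ.*-identityˡ e)

pointwise⇒≤ : ∀ {x y} → (∀ n → seq x n ℚ.≤ seq y n) → x ≤ᵣ y
pointwise⇒≤ {x} {y} x≤y e 0<e = 0 , λ n _ → ℚ.≤-<-trans (x≤y n)
  (subst (ℚ._< seq y n ℚ.+ e) (ℚ.+-identityʳ _) (ℚ.+-monoʳ-< (seq y n) 0<e))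

fromℚ-mono : ∀ {p q} → p ℚ.≤ q → fromℚ p ≤ᵣ fromℚ q
fromℚ-mono {p} {q} p≤q = pointwise⇒≤ {fromℚ p} {fromℚ q} λ _ → p≤q

-- If `q < p`, the tolerance `p - q` is positive, and the order at that tolerance would give
-- `p < q + (p - q) = p`.
fromℚ-cancel : ∀ {p q} → fromℚ p ≤ᵣ fromℚ q → p ℚ.≤ q
fromℚ-cancel {p} {q} p≤q with p ℚ.≤? q
... | yes h = h
... | no  h with p≤q (p ℚ.- q) 0<p-q
  where
  0<p-q : 0ℚ ℚ.< p ℚ.- q
  0<p-q = subst (ℚ._< p ℚ.- q) (ℚ.+-inverseʳ q) (ℚ.+-monoˡ-< (ℚ.- q) (ℚ.≰⇒> h))
... | N , f = contradiction
  (subst (p ℚ.<_) (trans (ℚ.+-comm q _) (//-rightDividesˡ q p)) (f N ℕ.≤-refl))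
  (ℚ.<-irrefl refl)

≤-trans : ∀ {x y z} → x ≤ᵣ y → y ≤ᵣ z → x ≤ᵣ z
≤-trans {x} {y} {z} x≤y y≤z e 0<e with x≤y _ (half-pos 0<e) | y≤z _ (half-pos 0<e)
... | M , f | N , g = M ℕ.⊔ N , λ n M⊔N≤n → begin-strict
  seq x n                             <⟨ f n (ℕ.m⊔n≤o⇒m≤o M N M⊔N≤n) ⟩
  seq y n ℚ.+ h                       <⟨ ℚ.+-monoˡ-< h (g n (ℕ.m⊔n≤o⇒n≤o M N M⊔N≤n)) ⟩
  seq z n ℚ.+ h ℚ.+ h                 ≡⟨ ℚ.+-assoc (seq z n) h h ⟩
  seq z n ℚ.+ (h ℚ.+ h)               ≡⟨ cong (seq z n ℚ.+_) (half+half e) ⟩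
  seq z n ℚ.+ e                       ∎
  where
  open ℚ.≤-Reasoning
  h = ½ ℚ.* e

≃-sym : ∀ {x y} → x ≃ y → y ≃ x
≃-sym {x} {y} x≃y e 0<e with x≃y e 0<e
... | N , f = N , λ n N≤n → subst (ℚ._< e) (d-comm (seq x n) (seq y n)) (f n N≤n)
  where
  d-comm : ∀ p q → ℚ.∣ p ℚ.- q ∣ ≡ ℚ.∣ q ℚ.- p ∣
  d-comm p q = trans (sym (ℚ.∣-p∣≡∣p∣ (p ℚ.- q))) (cong ℚ.∣_∣ (⁻¹-anti-homo-// p q))

≃⇒≤ : ∀ {x y} → x ≃ y → x ≤ᵣ y
≃⇒≤ {x} {y} x≃y e 0<e with x≃y e 0<e
... | N , f = N , λ n N≤n → begin-strict
  seq x n                               ≡⟨ //-rightDividesˡ (seq y n) (seq x n) ⟨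
  (seq x n ℚ.- seq y n) ℚ.+ seq y n     ≤⟨ ℚ.+-monoˡ-≤ (seq y n) (p≤∣p∣ (seq x n ℚ.- seq y n)) ⟩
  ℚ.∣ seq x n ℚ.- seq y n ∣ ℚ.+ seq y n <⟨ ℚ.+-monoˡ-< (seq y n) (f n N≤n) ⟩
  e ℚ.+ seq y n                         ≡⟨ ℚ.+-comm e (seq y n) ⟩
  seq y n ℚ.+ e                         ∎
  where
  open ℚ.≤-Reasoning
  p≤∣p∣ : ∀ p → p ℚ.≤ ℚ.∣ p ∣
  p≤∣p∣ p with ℚ.≤-total 0ℚ p
  ... | inj₁ 0≤p = ℚ.≤-reflexive (sym (ℚ.0≤p⇒∣p∣≡p 0≤p))
  ... | inj₂ p≤0 = ℚ.≤-trans p≤0 (ℚ.0≤∣p∣ p)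

≤-antisym : ∀ {x y} → x ≤ᵣ y → y ≤ᵣ x → x ≃ y
≤-antisym {x} {y} x≤y y≤x e 0<e with x≤y e 0<e | y≤x e 0<e
... | M , f | N , g = M ℕ.⊔ N , λ n M⊔N≤n →
  near (f n (ℕ.m⊔n≤o⇒m≤o M N M⊔N≤n)) (g n (ℕ.m⊔n≤o⇒n≤o M N M⊔N≤n))
  where
  <⇒-< : ∀ {p q} → p ℚ.< q ℚ.+ e → p ℚ.- q ℚ.< e
  <⇒-< {p} {q} h = subst (p ℚ.- q ℚ.<_)
    (trans (cong (ℚ._- q) (ℚ.+-comm q e)) (//-rightDividesʳ q e)) (ℚ.+-monoˡ-< (ℚ.- q) h)

  near : ∀ {p q} → p ℚ.< q ℚ.+ e → q ℚ.< p ℚ.+ e → ℚ.∣ p ℚ.- q ∣ ℚ.< e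
  near {p} {q} h k with ℚ.∣p∣≡p∨∣p∣≡-p (p ℚ.- q)
  ... | inj₁ eq = subst (ℚ._< e) (sym eq) (<⇒-< h)
  ... | inj₂ eq = subst (ℚ._< e) (sym (trans eq (⁻¹-anti-homo-// p q))) (<⇒-< k)

+-mono-≤ : ∀ {x y z w} → x ≤ᵣ z → y ≤ᵣ w → x +ᵣ y ≤ᵣ z +ᵣ w
+-mono-≤ {x} {y} {z} {w} x≤z y≤w e 0<e with x≤z _ (half-pos 0<e) | y≤w _ (half-pos 0<e)
... | M , f | N , g = M ℕ.⊔ N , λ n M⊔N≤n → begin-strict
  seq x n ℚ.+ seq y n                   <⟨ ℚ.+-mono-< (f n (ℕ.m⊔n≤o⇒m≤o M N M⊔N≤n))
                                                      (g n (ℕ.m⊔n≤o⇒n≤o M N M⊔N≤n)) ⟩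
  (seq z n ℚ.+ h) ℚ.+ (seq w n ℚ.+ h)   ≡⟨ interchange +-semigroup (seq z n) h (seq w n) h ⟩
  (seq z n ℚ.+ seq w n) ℚ.+ (h ℚ.+ h)   ≡⟨ cong (seq z n ℚ.+ seq w n ℚ.+_) (half+half e) ⟩
  (seq z n ℚ.+ seq w n) ℚ.+ e           ∎
  where
  open ℚ.≤-Reasoning
  +-semigroup = CommutativeMonoid.commutativeSemigroup ℚ.+-0-commutativeMonoid
  h = ½ ℚ.* e

⊔-lub : ∀ {x y z} → x ≤ᵣ z → y ≤ᵣ z → x ⊔ y ≤ᵣ z
⊔-lub {x} {y} x≤z y≤z e 0<e with x≤z e 0<e | y≤z e 0<e
... | M , f | N , g = M ℕ.⊔ N , λ n M⊔N≤n →
  ⊔-< (f n (ℕ.m⊔n≤o⇒m≤o M N M⊔N≤n)) (g n (ℕ.m⊔n≤o⇒n≤o M N M⊔N≤n))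
  where
  ⊔-< : ∀ {p q r} → p ℚ.< r → q ℚ.< r → p ℚ.⊔ q ℚ.< r
  ⊔-< {p} {q} h k with ℚ.⊔-sel p q
  ... | inj₁ eq = subst (ℚ._< _) (sym eq) h
  ... | inj₂ eq = subst (ℚ._< _) (sym eq) k

x≤x⊔y : ∀ x y → x ≤ᵣ x ⊔ y
x≤x⊔y x y = pointwise⇒≤ {x} {x ⊔ y} λ n → ℚ.p≤p⊔q (seq x n) (seq y n)

y≤x⊔y : ∀ x y → y ≤ᵣ x ⊔ y
y≤x⊔y x y = pointwise⇒≤ {y} {x ⊔ y} λ n → ℚ.p≤q⊔p (seq x n) (seq y n)

1/k≤1 : ∀ k .{{_ : NonZero k}} → + 1 / k ℚ.≤ 1ℚ
1/k≤1 (suc m) rewrite ℚ.normalize-coprime {1} {m} (1-coprimeTo (suc m)) =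
  ℚ.*≤* (ℤ.+≤+ (ℕ.s≤s ℕ.z≤n))

-- Division by `k` scales the tolerance as well, and `1 / k ≤ 1`, so the same index `N` serves.
÷-mono-≤ : ∀ {x y} k .{{_ : NonZero k}} → x ≤ᵣ y → x ÷ k ≤ᵣ y ÷ k
÷-mono-≤ {x} {y} k x≤y e 0<e with x≤y e 0<e
... | N , f = N , λ n N≤n → begin-strict
  seq x n ℚ.* r              <⟨ ℚ.*-monoˡ-<-pos r (f n N≤n) ⟩
  (seq y n ℚ.+ e) ℚ.* r      ≡⟨ ℚ.*-distribʳ-+ r (seq y n) e ⟩
  seq y n ℚ.* r ℚ.+ e ℚ.* r  ≤⟨ ℚ.+-monoʳ-≤ (seq y n ℚ.* r)
                                 (ℚ.*-monoˡ-≤-nonNeg e {{ℚ.nonNegative (ℚ.<⇒≤ 0<e)}} (1/k≤1 k)) ⟩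
  seq y n ℚ.* r ℚ.+ e ℚ.* 1ℚ ≡⟨ cong (seq y n ℚ.* r ℚ.+_) (ℚ.*-identityʳ e) ⟩
  seq y n ℚ.* r ℚ.+ e        ∎
  where
  open ℚ.≤-Reasoning
  r = + 1 / k
  instance
    r>0 : ℚ.Positive r
    r>0 = ℚ.normalize-pos 1 k

-- ℝmax as an ordered semiring

≤-refl : ∀ {x} → x ≤ᵣ x
≤-refl {x} = pointwise⇒≤ {x} {x} λ _ → ℚ.≤-refl

≤₋-refl : ∀ {a} → a ≤₋ a
≤₋-refl {⊥₋}    = ⊥₋≤ ⊥₋
≤₋-refl {[ x ]} = [ ≤-refl {x} ]

≈⇒≤₋ : ∀ {a b} → a ≈₋ b → a ≤₋ b
≈⇒≤₋ ⊥₋≈⊥₋                   = ⊥₋≤ ⊥₋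
≈⇒≤₋ {[ x ]} {[ y ]} [ x≃y ] = [ ≃⇒≤ {x} {y} x≃y ]

≈⇒≥₋ : ∀ {a b} → a ≈₋ b → b ≤₋ a
≈⇒≥₋ ⊥₋≈⊥₋                   = ⊥₋≤ ⊥₋
≈⇒≥₋ {[ x ]} {[ y ]} [ x≃y ] = [ ≃⇒≤ {y} {x} (≃-sym {x} {y} x≃y) ]

≤₋-antisym : ∀ {a b} → a ≤₋ b → b ≤₋ a → a ≈₋ b
≤₋-antisym                   (⊥₋≤ _) (⊥₋≤ _) = ⊥₋≈⊥₋
≤₋-antisym {[ x ]} {[ y ]}   [ x≤y ] [ y≤x ] = [ ≤-antisym {x} {y} x≤y y≤x ]

≤₋-transitive : ∀ {a b c} → a ≤₋ b → b ≤₋ c → a ≤₋ c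
≤₋-transitive = ≤₋-trans λ {x} {y} {z} → ≤-trans {x} {y} {z}

a≤a⊕b : ∀ a b → a ≤₋ a ⊕ b
a≤a⊕b ⊥₋    b     = ⊥₋≤ b
a≤a⊕b [ x ] ⊥₋    = ≤₋-refl
a≤a⊕b [ x ] [ y ] = [ x≤x⊔y x y ]

b≤a⊕b : ∀ a b → b ≤₋ a ⊕ b
b≤a⊕b ⊥₋    b     = ≤₋-refl
b≤a⊕b [ x ] ⊥₋    = ⊥₋≤ _
b≤a⊕b [ x ] [ y ] = [ y≤x⊔y x y ]

⊕-lub : ∀ {a b c} → a ≤₋ c → b ≤₋ c → a ⊕ b ≤₋ c
⊕-lub (⊥₋≤ _) q       = q
⊕-lub [ p ]   (⊥₋≤ _) = [ p ]
⊕-lub {[ x ]} {[ y ]} {[ z ]} [ p ] [ q ] = [ ⊔-lub {x} {y} {z} p q ]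

⊙-mono-≤ : ∀ {a b c d} → a ≤₋ c → b ≤₋ d → a ⊙ b ≤₋ c ⊙ d
⊙-mono-≤ (⊥₋≤ _) _       = ⊥₋≤ _
⊙-mono-≤ [ p ]   (⊥₋≤ _) = ⊥₋≤ _
⊙-mono-≤ {[ x ]} {[ y ]} {[ z ]} {[ w ]} [ p ] [ q ] = [ +-mono-≤ {x} {y} {z} {w} p q ]

⊙-zeroʳ : ∀ a → a ⊙ ⊥₋ ≡ ⊥₋
⊙-zeroʳ ⊥₋    = refl
⊙-zeroʳ [ _ ] = refl

∑ : ∀ {n} → (Fin n → ℝmax) → ℝmax
∑ = foldr _⊕_ ⊥₋

term≤∑ : ∀ {n} (f : Fin n → ℝmax) l → f l ≤₋ ∑ f
term≤∑ f Fin.zero    = a≤a⊕b _ _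
term≤∑ f (Fin.suc l) = ≤₋-transitive (term≤∑ (λ i → f (Fin.suc i)) l) (b≤a⊕b _ _)

∑-lub : ∀ {n} {f : Fin n → ℝmax} {a} → (∀ l → f l ≤₋ a) → ∑ f ≤₋ a
∑-lub {zero}  _   = ⊥₋≤ _
∑-lub {suc n} f≤a = ⊕-lub (f≤a Fin.zero) (∑-lub λ l → f≤a (Fin.suc l))

⊗-monoʳ-≤ : ∀ {n} (A : Matrix n) {B C : Matrix n} {j} →
            (∀ l → B l j ≤₋ C l j) → ∀ i → (A ⊗ B) i j ≤₋ (A ⊗ C) i j
⊗-monoʳ-≤ A {C = C} {j} B≤C i = ∑-lub λ l →
  ≤₋-transitive (⊙-mono-≤ ≤₋-refl (B≤C l)) (term≤∑ (λ l → A i l ⊙ C l j) l)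

⊗-congˡ : ∀ {n} (A : Matrix n) {B C : Matrix n} → B ≈ C → A ⊗ B ≈ A ⊗ C
⊗-congˡ A {B} {C} B≈C i j = ≤₋-antisym
  (⊗-monoʳ-≤ A {B} {C} (λ l → ≈⇒≤₋ (B≈C l j)) i)
  (⊗-monoʳ-≤ A {C} {B} (λ l → ≈⇒≥₋ (B≈C l j)) i)

⟦_⟧ : ℚ → ℝmax
⟦ q ⟧ = [ fromℚ q ]

⟦⟧-mono-≤ : ∀ {p q} → p ℚ.≤ q → ⟦ p ⟧ ≤₋ ⟦ q ⟧
⟦⟧-mono-≤ p≤q = [ fromℚ-mono p≤q ]

⊗-lower : ∀ {n} {A B : Matrix n} {i l j p q} →
          ⟦ p ⟧ ≤₋ A i l → ⟦ q ⟧ ≤₋ B l j → ⟦ p ℚ.+ q ⟧ ≤₋ (A ⊗ B) i j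
-- `fromℚ (p + q)` and `fromℚ p +ᵣ fromℚ q` differ only in their Cauchy proofs, which the order does
-- not inspect.
⊗-lower {A = A} {B} {i} {l} {j} p≤a q≤b = ≤₋-transitive [ fromℚ-mono ℚ.≤-refl ]
  (≤₋-transitive (⊙-mono-≤ p≤a q≤b) (term≤∑ (λ l → A i l ⊙ B l j) l))

⊙-upper : ∀ {a b p q} → a ≤₋ ⟦ p ⟧ → b ≤₋ ⟦ q ⟧ → a ⊙ b ≤₋ ⟦ p ℚ.+ q ⟧
⊙-upper a≤p b≤q = ≤₋-transitive (⊙-mono-≤ a≤p b≤q) [ fromℚ-mono ℚ.≤-refl ]

-- A fold leaves the initial matrix free, so the same bounds on walks apply to powers, which start
-- from `I`, and to word products, which start from `A₂ ⊗ I`.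
^-fold : ∀ {n} (A : Matrix n) m → A ^ m ≡ fold I (A ⊗_) m
^-fold A zero    = refl
^-fold A (suc m) = cong (A ⊗_) (^-fold A m)

-- Walks and cycles

-- Here `h` is a potential that grows by 1 modulo `g` along every edge. The multiple of `g` stands
-- on the right because `h` can only drop by wrapping around.
walk-length : ∀ {n} {E : Rel (Fin n) 0ℓ} (h : Fin n → ℕ) g →
              (∀ {i j} → E i j → ∃[ q ] suc (h i) ≡ h j + q * g) →
              ∀ {i j} (w : Star E i j) → ∃[ q ] h i + length (edges w) ≡ h j + q * g
walk-length h g step ε = 0 , refl
walk-length h g step {i} {k} (_◅_ {j = j} e w) with step e | walk-length h g step w
... | q , eq | q′ , eq′ = q′ + q , (begin
  h i + suc (length (edges w))     ≡⟨ ℕ.+-suc (h i) _ ⟩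
  suc (h i) + length (edges w)     ≡⟨ cong (_+ length (edges w)) eq ⟩
  h j + q * g + length (edges w)   ≡⟨ xy∙z≈xz∙y (h j) (q * g) _ ⟩
  h j + length (edges w) + q * g   ≡⟨ cong (_+ q * g) eq′ ⟩
  h k + q′ * g + q * g             ≡⟨ ℕ.+-assoc (h k) (q′ * g) (q * g) ⟩
  h k + (q′ * g + q * g)           ≡⟨ cong (_+_ (h k)) (ℕ.*-distribʳ-+ g q′ q) ⟨
  h k + (q′ + q) * g               ∎)
  where
  open ≡-Reasoning
  open import Algebra.Properties.CommutativeSemigroup ℕ.+-commutativeSemigroup using (xy∙z≈xz∙y)

-- On a closed walk the potentials of the two ends cancel.
potential⇒∣len : ∀ {n} {D : Digraph n} (h : Fin n → ℕ) g →
                 (∀ {i j} → Edge D i j → ∃[ q ] suc (h i) ≡ h j + q * g) →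
                 (c : Cycle D) → g ∣ len c
potential⇒∣len h g step c with walk-length h g step (walk c)
... | q , eq = divides q (ℕ.+-cancelˡ-≡ (h (base c)) _ _ eq)

edges-map : ∀ {n} {E F : Rel (Fin n) 0ℓ} (f : E ⇒ F) {i j} (w : Star E i j) →
            edges (Star.map f w) ≡ edges w
edges-map f ε       = refl
edges-map f (e ◅ w) = cong (_ ∷_) (edges-map f w)

mapCycle : ∀ {n} {D E : Digraph n} → Edge D ⇒ Edge E → Cycle D → Cycle E
mapCycle f c = record
  { base   = base c
  ; walk   = Star.map f (walk c)
  ; len≢0  = subst (λ es → NonZero (length es)) (sym (edges-map f (walk c))) (len≢0 c)
  ; simple = subst (λ es → Unique (List.map proj₁ es)) (sym (edges-map f (walk c))) (simple c)
  }

len-mapCycle : ∀ {n} {D E : Digraph n} (f : Edge D ⇒ Edge E) (c : Cycle D) →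
               len (mapCycle {E = E} f c) ≡ len c
len-mapCycle f c = cong length (edges-map f (walk c))

simpleCycle : ∀ (D : Digraph 6) {i} (w : Star (Edge D) i i) {{_ : NonZero (length (edges w))}}
              {_ : True (unique? (List.map proj₁ (edges w)))} → Cycle D
simpleCycle D w {unique} = record { walk = w ; simple = toWitness unique }

-- The digraphs of the example

data Detour : Rel (Fin 6) 0ℓ where
  d₃₅ : Detour 2F 4F
  d₅₆ : Detour 4F 5F
  d₆₄ : Detour 5F 3F

C₄-edge? : ∀ i j → Dec (C₄-Edge i j)
C₄-edge? i j = map′ to from
  ((i , j) ∈? (0F , 1F) ∷ (1F , 2F) ∷ (2F , 3F) ∷ (3F , 0F) ∷ [])
  where
  to : (i , j) ∈ (0F , 1F) ∷ (1F , 2F) ∷ (2F , 3F) ∷ (3F , 0F) ∷ [] → C₄-Edge i j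
  to (here refl)                         = e₁₂
  to (there (here refl))                 = e₂₃
  to (there (there (here refl)))         = e₃₄
  to (there (there (there (here refl)))) = e₄₁
  from : C₄-Edge i j → (i , j) ∈ (0F , 1F) ∷ (1F , 2F) ∷ (2F , 3F) ∷ (3F , 0F) ∷ []
  from e₁₂ = here refl
  from e₂₃ = there (here refl)
  from e₃₄ = there (there (here refl))
  from e₄₁ = there (there (there (here refl)))

detour? : ∀ i j → Dec (Detour i j)
detour? i j = map′ to from ((i , j) ∈? (2F , 4F) ∷ (4F , 5F) ∷ (5F , 3F) ∷ [])
  where
  to : (i , j) ∈ (2F , 4F) ∷ (4F , 5F) ∷ (5F , 3F) ∷ [] → Detour i j
  to (here refl)                 = d₃₅
  to (there (here refl))         = d₅₆
  to (there (there (here refl))) = d₆₄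
  from : Detour i j → (i , j) ∈ (2F , 4F) ∷ (4F , 5F) ∷ (5F , 3F) ∷ []
  from d₃₅ = here refl
  from d₅₆ = there (here refl)
  from d₆₄ = there (there (here refl))

≡⊥? : (a : ℝmax) → Dec (a ≡ ⊥₋)
≡⊥? ⊥₋    = yes refl
≡⊥? [ _ ] = no λ ()

Arc : Rel (Fin 6) 0ℓ
Arc i j = C₄-Edge i j ⊎ Detour i j

edge⇒arc : ∀ {x} i j → example x i j ≢ ⊥₋ → Arc i j
-- Which entries are `⊥₋` does not depend on the value of `x`, so the check of all 36 pairs
-- evaluates with `x` a variable.
edge⇒arc {x} = from-yes arcs?
  where
  arcs? : Dec (∀ i j → example x i j ≢ ⊥₋ → Arc i j)
  arcs? = all? λ i → all? λ j →
    ¬? (≡⊥? (example x i j)) →-dec (C₄-edge? i j ⊎-dec detour? i j)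

arc⇒edge : ∀ {x i j} → Arc i j → example x i j ≢ ⊥₋
arc⇒edge (inj₁ e₁₂) = λ ()
arc⇒edge (inj₁ e₂₃) = λ ()
arc⇒edge (inj₁ e₃₄) = λ ()
arc⇒edge (inj₁ e₄₁) = λ ()
arc⇒edge (inj₂ d₃₅) = λ ()
arc⇒edge (inj₂ d₅₆) = λ ()
arc⇒edge (inj₂ d₆₄) = λ ()

-- The cycle is rotated so that the given edge comes first; its membership in the cycle is then
-- immediate.
C₄-cycle : ∀ {i j} → C₄-Edge i j → Cycle C₄
C₄-cycle e₁₂ = simpleCycle C₄ (e₁₂ ◅ e₂₃ ◅ e₃₄ ◅ e₄₁ ◅ ε)
C₄-cycle e₂₃ = simpleCycle C₄ (e₂₃ ◅ e₃₄ ◅ e₄₁ ◅ e₁₂ ◅ ε)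
C₄-cycle e₃₄ = simpleCycle C₄ (e₃₄ ◅ e₄₁ ◅ e₁₂ ◅ e₂₃ ◅ ε)
C₄-cycle e₄₁ = simpleCycle C₄ (e₄₁ ◅ e₁₂ ◅ e₂₃ ◅ e₃₄ ◅ ε)

C₄-cyclicity : HasCyclicity C₄ 4
C₄-cyclicity = record
  { connected = λ _ _ i j → to₁ i ◅◅ from₁ j
  ; divides   = potential⇒∣len toℕ 4 λ where
      e₁₂ → 0 , refl
      e₂₃ → 0 , refl
      e₃₄ → 0 , refl
      e₄₁ → 1 , refl
  ; greatest  = λ _ d∣len → d∣len (C₄-cycle e₁₂)
  }
  where
  to₁ : ∀ {i} → C₄-Node i → Star C₄-Edge i 0F
  to₁ n₁ = ε
  to₁ n₂ = e₂₃ ◅ e₃₄ ◅ e₄₁ ◅ ε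
  to₁ n₃ = e₃₄ ◅ e₄₁ ◅ ε
  to₁ n₄ = e₄₁ ◅ ε
  from₁ : ∀ {j} → C₄-Node j → Star C₄-Edge 0F j
  from₁ n₁ = ε
  from₁ n₂ = e₁₂ ◅ ε
  from₁ n₃ = e₁₂ ◅ e₂₃ ◅ ε
  from₁ n₄ = e₁₂ ◅ e₂₃ ◅ e₃₄ ◅ ε

-- Every arc switches the colour in a two-colouring of the nodes, so all cycles are even.
-- Conversely, a common divisor divides 6, from the Hamiltonian cycle through the detour, and 4,
-- from the cycle around `C₄`, hence also 2.
example-cyclicity : ∀ {x} → HasCyclicity (digraph (example x)) 2
example-cyclicity {x} = record
  { connected = λ i j _ _ → Star.map arc⇒edge (to₁ i ◅◅ from₁ j)
  ; divides   = potential⇒∣len parity 2 λ {i} {j} e → alternates (edge⇒arc i j e)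
  ; greatest  = λ g g∣len → ∣m+n∣m⇒∣n
      (g∣len (mapCycle arc⇒edge hamiltonian))
      (g∣len (mapCycle (λ e → arc⇒edge (inj₁ e)) (C₄-cycle e₁₂)))
  }
  where
  to₁ : ∀ i → Star Arc i 0F
  to₁ 0F = ε
  to₁ 1F = inj₁ e₂₃ ◅ inj₁ e₃₄ ◅ inj₁ e₄₁ ◅ ε
  to₁ 2F = inj₁ e₃₄ ◅ inj₁ e₄₁ ◅ ε
  to₁ 3F = inj₁ e₄₁ ◅ ε
  to₁ 4F = inj₂ d₅₆ ◅ inj₂ d₆₄ ◅ inj₁ e₄₁ ◅ ε
  to₁ 5F = inj₂ d₆₄ ◅ inj₁ e₄₁ ◅ ε

  from₁ : ∀ j → Star Arc 0F j
  from₁ 0F = ε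
  from₁ 1F = inj₁ e₁₂ ◅ ε
  from₁ 2F = inj₁ e₁₂ ◅ inj₁ e₂₃ ◅ ε
  from₁ 3F = inj₁ e₁₂ ◅ inj₁ e₂₃ ◅ inj₁ e₃₄ ◅ ε
  from₁ 4F = inj₁ e₁₂ ◅ inj₁ e₂₃ ◅ inj₂ d₃₅ ◅ ε
  from₁ 5F = inj₁ e₁₂ ◅ inj₁ e₂₃ ◅ inj₂ d₃₅ ◅ inj₂ d₅₆ ◅ ε

  hamiltonian : Cycle (record { Node = λ _ → Fin 6 ; Edge = Arc })
  hamiltonian = simpleCycle _ (from₁ 5F ◅◅ to₁ 5F)

  parity : Fin 6 → ℕ
  parity 0F = 0
  parity 1F = 1
  parity 2F = 0
  parity 3F = 1
  parity 4F = 1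
  parity 5F = 0

  alternates : ∀ {i j} → Arc i j → ∃[ q ] suc (parity i) ≡ parity j + q * 2
  alternates (inj₁ e₁₂) = 0 , refl
  alternates (inj₁ e₂₃) = 1 , refl
  alternates (inj₁ e₃₄) = 0 , refl
  alternates (inj₁ e₄₁) = 1 , refl
  alternates (inj₂ d₃₅) = 0 , refl
  alternates (inj₂ d₅₆) = 1 , refl
  alternates (inj₂ d₆₄) = 0 , refl

example-digraphs : ∀ x y → digraph (example x) ≋ digraph (example y)
example-digraphs x y = ((λ u → u) , (λ u → u)) ,
  (λ {i} {j} e → arc⇒edge (edge⇒arc i j e)) , (λ {i} {j} e → arc⇒edge (edge⇒arc i j e))

-- Weights of walks and critical cycles

weight≤0 : ∀ {n} (A : Matrix n) → (∀ i j e → finite (A i j) e ≤ᵣ fromℚ 0ℚ) →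
           ∀ {i j} (w : Star (Edge (digraph A)) i j) → weight A w ≤ᵣ fromℚ 0ℚ
weight≤0 A A≤0 ε       = ≤-refl {fromℚ 0ℚ}
weight≤0 A A≤0 (_◅_ {i} {j} e w) = +-mono-≤
  {finite (A i j) e} {weight A w} {fromℚ 0ℚ} {fromℚ 0ℚ} (A≤0 i j e) (weight≤0 A A≤0 w)

-- No edge has positive weight, so dropping all the other edges of the walk can only raise its
-- weight.
weight≤edge : ∀ {n} (A : Matrix n) → (∀ i j e → finite (A i j) e ≤ᵣ fromℚ 0ℚ) →
              ∀ {i j k l} (w : Star (Edge (digraph A)) k l) → (i , j) ∈ edges w →
              ∃[ e ] weight A w ≤ᵣ finite (A i j) e
weight≤edge A A≤0 (_◅_ {i} {j} e w) (here refl) = e , ≤-trans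
  {weight A (e ◅ w)} {a +ᵣ fromℚ 0ℚ} {a}
  (+-mono-≤ {a} {weight A w} {a} {fromℚ 0ℚ} (≤-refl {a}) (weight≤0 A A≤0 w))
  (pointwise⇒≤ {a +ᵣ fromℚ 0ℚ} {a} λ n → ℚ.≤-reflexive (ℚ.+-identityʳ (seq a n)))
  where a = finite (A i j) e
weight≤edge A A≤0 {i} {j} (_◅_ {k} {m} e w) (there ij∈w) with weight≤edge A A≤0 w ij∈w
... | e′ , w≤a = e′ , ≤-trans {weight A (e ◅ w)} {fromℚ 0ℚ +ᵣ a} {a}
  (+-mono-≤ {finite (A k m) e} {weight A w} {fromℚ 0ℚ} {a} (A≤0 k m e) w≤a)
  (pointwise⇒≤ {fromℚ 0ℚ +ᵣ a} {a} λ n → ℚ.≤-reflexive (ℚ.+-identityˡ (seq a n)))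
  where a = finite (A i j) e′

loss : ℕ → ℚ
loss n = ℤ.- + n / 1

module _ {x : ℤ} (x≤-1 : x / 1 ℚ.≤ loss 1) where

  private
    A = example x
    x≤0 : x / 1 ℚ.≤ 0ℚ
    x≤0 = ℚ.≤-trans x≤-1 (from-yes (loss 1 ℚ.≤? 0ℚ))

  edge≤0 : ∀ i j e → finite (A i j) e ≤ᵣ fromℚ 0ℚ
  edge≤0 i j e with edge⇒arc i j e
  ... | inj₁ e₁₂ = fromℚ-mono (ℚ.≤-refl {0ℚ})
  ... | inj₁ e₂₃ = fromℚ-mono (ℚ.≤-refl {0ℚ})
  ... | inj₁ e₃₄ = fromℚ-mono (ℚ.≤-refl {0ℚ})
  ... | inj₁ e₄₁ = fromℚ-mono (ℚ.≤-refl {0ℚ})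
  ... | inj₂ d₃₅ = fromℚ-mono x≤0
  ... | inj₂ d₅₆ = fromℚ-mono (from-yes (loss 100 ℚ.≤? 0ℚ))
  ... | inj₂ d₆₄ = fromℚ-mono x≤0

  detour≤-1 : ∀ {i j} → Detour i j → ∀ e → finite (A i j) e ≤ᵣ fromℚ (loss 1)
  detour≤-1 d₃₅ _ = fromℚ-mono x≤-1
  detour≤-1 d₅₆ _ = fromℚ-mono (from-yes (loss 100 ℚ.≤? loss 1))
  detour≤-1 d₆₄ _ = fromℚ-mono x≤-1

  critical-cycle : ∀ {i j} → C₄-Edge i j → Cycle (digraph A)
  critical-cycle e = mapCycle (λ e → arc⇒edge (inj₁ e)) (C₄-cycle e)

  0≤mean : ∀ {i j} (e : C₄-Edge i j) → fromℚ 0ℚ ≤ᵣ mean A (critical-cycle e)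
  0≤mean e₁₂ = fromℚ-mono (ℚ.≤-refl {0ℚ})
  0≤mean e₂₃ = fromℚ-mono (ℚ.≤-refl {0ℚ})
  0≤mean e₃₄ = fromℚ-mono (ℚ.≤-refl {0ℚ})
  0≤mean e₄₁ = fromℚ-mono (ℚ.≤-refl {0ℚ})

  -- Every mean is at most 0 because no weight is positive, and the cycle around `C₄` attains 0.
  critical-cycle-critical : ∀ {i j} (e : C₄-Edge i j) → Critical A (critical-cycle e)
  critical-cycle-critical e c = ≤-trans
    {mean A c} {fromℚ 0ℚ ÷ len c} {mean A (critical-cycle e)}
    (÷-mono-≤ {weight A (walk c)} {fromℚ 0ℚ} (len c) (weight≤0 A edge≤0 (walk c)))
    (≤-trans {fromℚ 0ℚ ÷ len c} {fromℚ 0ℚ} {mean A (critical-cycle e)}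
      (fromℚ-mono (ℚ.≤-reflexive (ℚ.*-zeroˡ (+ 1 / len c)))) (0≤mean e))

  -- A critical cycle has mean at least 0, the mean of the cycle around `C₄`. An arc of the detour
  -- would push its weight to -1 or below, and so its mean below 0.
  critical⇒C₄ : ∀ {i j} c → Critical A c → (i , j) ∈ edges (walk c) → C₄-Edge i j
  critical⇒C₄ {i} {j} c c-critical ij∈c with weight≤edge A edge≤0 (walk c) ij∈c
  ... | e , w≤a with edge⇒arc i j e
  ...   | inj₁ e′ = e′
  ...   | inj₂ d  = contradiction
      (ℚ.≤-<-trans (fromℚ-cancel 0≤-1/len) -1/len<0) (ℚ.<-irrefl refl)
    where
    r = + 1 / len c
    -1/len<0 : loss 1 ℚ.* r ℚ.< 0ℚ
    -1/len<0 = subst (loss 1 ℚ.* r ℚ.<_) (ℚ.*-zeroˡ r)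
      (ℚ.*-monoˡ-<-pos r {{ℚ.normalize-pos 1 (len c)}} (from-yes (loss 1 ℚ.<? 0ℚ)))

    w≤-1 : weight A (walk c) ≤ᵣ fromℚ (loss 1)
    w≤-1 = ≤-trans {weight A (walk c)} {finite (A i j) e} {fromℚ (loss 1)} w≤a (detour≤-1 d e)

    0≤-1/len : fromℚ 0ℚ ≤ᵣ fromℚ (loss 1 ℚ.* r)
    0≤-1/len = ≤-trans {fromℚ 0ℚ} {mean A c} {fromℚ (loss 1 ℚ.* r)}
      (≤-trans {fromℚ 0ℚ} {mean A (critical-cycle e₁₂)} {mean A c}
        (0≤mean e₁₂) (c-critical (critical-cycle e₁₂)))
      (÷-mono-≤ {weight A (walk c)} {fromℚ (loss 1)} (len c) w≤-1)

  criticalDigraph-example : criticalDigraph A ≋ C₄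
  criticalDigraph-example = (node⇒ , node⇐) ,
    (λ (c , c-critical , ij∈c) → critical⇒C₄ c c-critical ij∈c) ,
    (λ e → critical-cycle e , critical-cycle-critical e , first-edge e)
    where
    source : ∀ {i j} → C₄-Edge i j → C₄-Node i
    source e₁₂ = n₁
    source e₂₃ = n₂
    source e₃₄ = n₃
    source e₄₁ = n₄

    first-edge : ∀ {i j} (e : C₄-Edge i j) → (i , j) ∈ edges (walk (critical-cycle e))
    first-edge e₁₂ = here refl
    first-edge e₂₃ = here refl
    first-edge e₃₄ = here refl
    first-edge e₄₁ = here refl

    node⇒ : ∀ {i} → Node (criticalDigraph A) i → C₄-Node i
    node⇒ (c , c-critical , i∈c) with ∈-map⁻ proj₁ i∈c
    ... | _ , ij∈c , refl = source (critical⇒C₄ c c-critical ij∈c)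

    start : ∀ {i j} → C₄-Edge i j → Node (criticalDigraph A) i
    start e = critical-cycle e , critical-cycle-critical e , ∈-map⁺ proj₁ (first-edge e)

    node⇐ : ∀ {i} → C₄-Node i → Node (criticalDigraph A) i
    node⇐ n₁ = start e₁₂
    node⇐ n₂ = start e₂₃
    node⇐ n₃ = start e₃₄
    node⇐ n₄ = start e₄₁

-- The CSR data of the example

C₄-matrix : Matrix 6
C₄-matrix i j = if does (C₄-edge? i j) then 𝟘 else ⊥₋

-- Equality of reals is not decidable, but equality of single terms of their sequences is, so
-- identities between explicit matrices can be settled by evaluation.
value : ℕ → ℝmax → Maybe ℚ
value n = Maybe.map λ x → seq x n

value⇒≈ : ∀ {a b} → (∀ n → value n a ≡ value n b) → a ≈₋ b
value⇒≈ {⊥₋}    {⊥₋}    _  = ⊥₋≈⊥₋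
value⇒≈ {⊥₋}    {[ _ ]} eq = contradiction (eq 0) λ ()
value⇒≈ {[ _ ]} {⊥₋}    eq = contradiction (eq 0) λ ()
value⇒≈ {[ x ]} {[ y ]} eq = [ ≤-antisym {x} {y}
  (pointwise⇒≤ {x} {y} λ n → ℚ.≤-reflexive (Maybe.just-injective (eq n)))
  (pointwise⇒≤ {y} {x} λ n → ℚ.≤-reflexive (Maybe.just-injective (sym (eq n)))) ]

-- Only `S ^ 5 ≈ S ^ 1` is computed; multiplying by `S` on the left gives the rest.
C₄-matrix-periodic : ∀ l → C₄-matrix ^ (suc l + 4) ≈ C₄-matrix ^ suc l
C₄-matrix-periodic zero    i j = value⇒≈ λ n → from-yes (values? n) i j
  where
  values? : ∀ n → Dec (∀ i j → value n ((C₄-matrix ^ 5) i j) ≡ value n ((C₄-matrix ^ 1) i j))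
  values? n = all? λ i → all? λ j → Maybe.≡-dec ℚ._≟_ _ _
C₄-matrix-periodic (suc l) = ⊗-congˡ C₄-matrix (C₄-matrix-periodic l)

A₁,₂-critical : ∀ s → criticalDigraph (A₁,₂ s) ≋ C₄
A₁,₂-critical 0F = criticalDigraph-example (from-yes (loss 100 ℚ.≤? loss 1))
A₁,₂-critical 1F = criticalDigraph-example ℚ.≤-refl

A₁,₂-CSRData : CSRData A₁,₂
A₁,₂-CSRData = record
  { critical  = C₄
  ; common    = A₁,₂-critical
  ; γ         = 4
  ; cyclicity = C₄-cyclicity
  ; S         = C₄-matrix
  ; S-edge    = S-edge
  ; S-nonEdge = S-nonEdge
  ; T         = 1
  ; periodic  = λ where (suc l) _ → C₄-matrix-periodic l
  ; least     = least
  ; t₀        = 1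
  ; T≤t₀γ     = ℕ.s≤s ℕ.z≤n
  }
  where
  S-edge : ∀ i j → C₄-Edge i j → C₄-matrix i j ≈₋ 𝟘
  S-edge i j e rewrite dec-true (C₄-edge? i j) e = value⇒≈ {𝟘} {𝟘} λ _ → refl

  S-nonEdge : ∀ i j → ¬ C₄-Edge i j → C₄-matrix i j ≈₋ ⊥₋
  S-nonEdge i j ¬e rewrite dec-false (C₄-edge? i j) ¬e = ⊥₋≈⊥₋

  least : ∀ T → Periodic C₄-matrix 4 T → 1 ≤ T
  -- Exponent 0 fails off the cycle: the diagonal entry at `4F` is `𝟘` in the identity and `⊥₋` in
  -- the fourth power.
  least zero    p with p 0 ℕ.z≤n 4F 4F
  ... | ()
  least (suc T) _ = ℕ.s≤s ℕ.z≤n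

-- Arbitrary data `d` come with their own critical digraph, which is compared with `C₄` through that
-- of `A₁`: its cycles are cycles of `C₄`, so 4 is a common divisor of their lengths. This is what
-- makes a number of steps divisible by `γ` a return to the start on `C₄`.
4∣γ : (d : CSRData A₁,₂) → 4 ∣ CSRData.γ d
4∣γ d = HasCyclicity.greatest cyclicity 4 λ c →
  subst (4 ∣_) (len-mapCycle {E = C₄} critical⇒C₄-edge c)
    (HasCyclicity.divides C₄-cyclicity (mapCycle {E = C₄} critical⇒C₄-edge c))
  where
  open CSRData d
  critical⇒C₄-edge : Edge critical ⇒ C₄-Edge
  critical⇒C₄-edge e = proj₁ (proj₂ (A₁,₂-critical 0F)) (proj₂ (proj₂ (common 0F)) e)

S-lower : (d : CSRData A₁,₂) → ∀ {i j} → C₄-Edge i j → 𝟘 ≤₋ CSRData.S d i j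
S-lower d e = ≈⇒≥₋
  (S-edge _ _ (proj₁ (proj₂ (common 0F)) (proj₂ (proj₂ (A₁,₂-critical 0F)) e)))
  where open CSRData d

-- Lower bounds from walks around C₄

-- Positions on `C₄` are counted modulo 4; the recursion makes `node (4 + n)` reduce to `node n`.
node : ℕ → Fin 6
node 0 = 0F
node 1 = 1F
node 2 = 2F
node 3 = 3F
node (suc (suc (suc (suc n)))) = node n

node-edge : ∀ n → C₄-Edge (node n) (node (suc n))
node-edge 0 = e₁₂
node-edge 1 = e₂₃
node-edge 2 = e₃₄
node-edge 3 = e₄₁
node-edge (suc (suc (suc (suc n)))) = node-edge n

4∣-periodic : ∀ {A : Set} (f : ℕ → A) → (∀ n → f (4 + n) ≡ f n) →
           ∀ {m} → 4 ∣ m → ∀ n → f (m + n) ≡ f n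
4∣-periodic f f-periodic (divides-refl q) = go q
  where
  go : ∀ q n → f (q * 4 + n) ≡ f n
  go zero    n = refl
  go (suc q) n = trans (f-periodic (q * 4 + n)) (go q n)

-- From position `a`, take `l` free steps around `C₄` and continue with `X` at position `l + a`.
fold-lower : ∀ {B : Matrix 6} → (∀ {i j} → C₄-Edge i j → 𝟘 ≤₋ B i j) →
             ∀ l {a X k q} → ⟦ q ⟧ ≤₋ X (node (l + a)) k →
             ⟦ q ⟧ ≤₋ fold X (B ⊗_) l (node a) k
fold-lower 0≤B zero    q≤X = q≤X
fold-lower {B} 0≤B (suc l) {a} {X} {k} {q} q≤X =
  subst (λ p → ⟦ p ⟧ ≤₋ fold X (B ⊗_) (suc l) (node a) k) (ℚ.+-identityˡ q)
    (⊗-lower {A = B} {fold X (B ⊗_) l} (0≤B (node-edge a)) (fold-lower 0≤B l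
      (subst (λ b → ⟦ q ⟧ ≤₋ X (node b) k) (sym (ℕ.+-suc l a)) q≤X)))

I-lower : ∀ {n} (i : Fin n) → ⟦ 0ℚ ⟧ ≤₋ I i i
I-lower i with i ≟ i
... | yes _  = ≤₋-refl
... | no i≢i = contradiction refl i≢i

^-lower : ∀ {B : Matrix 6} → (∀ {i j} → C₄-Edge i j → 𝟘 ≤₋ B i j) →
          ∀ l a → ⟦ 0ℚ ⟧ ≤₋ (B ^ l) (node a) (node (l + a))
^-lower {B} 0≤B l a rewrite ^-fold B l = fold-lower 0≤B l {X = I} (I-lower (node (l + a)))

A₁-lower : ∀ {i j} → C₄-Edge i j → 𝟘 ≤₋ A₁ i j
A₁-lower e₁₂ = ≤₋-refl
A₁-lower e₂₃ = ≤₋-refl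
A₁-lower e₃₄ = ≤₋-refl
A₁-lower e₄₁ = ≤₋-refl

-- The rows node (3 * m) are those from which m steps around C₄ end at node 0.
record Lossy (m : ℕ) (Γ : Matrix 6) : Set where
  field
    late-detour  : ⟦ loss 201 ⟧ ≤₋ Γ (node (3 * m)) 3F
    late-exit    : ∀ a → node (m + a) ≡ 2F → ⟦ loss 1 ⟧ ≤₋ Γ (node a) 4F
    early-detour : Γ (node (3 * m)) 4F ≤₋ ⟦ loss 301 ⟧

-- If the product were CSR, its entry in row `node (3 * m)` and column `4F` would be at least -202
-- by the walk in `CSR-lower`, and at most -301 by `early-detour`.
lossy⇒¬CSR : (d : CSRData A₁,₂) → ∀ m {Γ} → Lossy m Γ → ¬ IsCSR d (m + 1) Γ
lossy⇒¬CSR d m {Γ} lossy csr = from-no (loss 202 ℚ.≤? loss 301)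
  (fromℚ-cancel ([≤]-injective (≤₋-transitive CSR-lower
    (≤₋-transitive (≈⇒≥₋ (csr (node (3 * m)) 4F)) early-detour))))
  where
  open CSRData d
  open Lossy lossy

  k = m + 1
  v = k % γ
  p = (t₀ + 1) * γ ℕ.∸ v

  v+p≡ : v + p ≡ (t₀ + 1) * γ
  v+p≡ = ℕ.m+[n∸m]≡n (ℕ.<⇒≤ (ℕ.<-≤-trans (m%n<n k γ)
    (ℕ.m≤n*m γ (t₀ + 1) {{ℕ.>-nonZero (ℕ.m≤n+m 1 t₀)}})))

  node-period : ∀ q n → node (q * γ + n) ≡ node n
  node-period q = 4∣-periodic node (λ _ → refl) (∣n⇒∣m*n q (4∣γ d))

  -- The powers `S ^ p` and `S ^ v` together make `(t₀ + 1) * γ` steps, which lead from `3F` back to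
  -- `3F`.
  node[v+[p+3]] : node (v + (p + 3)) ≡ 3F
  node[v+[p+3]] = begin
    node (v + (p + 3))         ≡⟨ cong node (ℕ.+-assoc v p 3) ⟨
    node (v + p + 3)           ≡⟨ cong (λ n → node (n + 3)) v+p≡ ⟩
    node ((t₀ + 1) * γ + 3)    ≡⟨ node-period (t₀ + 1) 3 ⟩
    3F                         ∎
    where open ≡-Reasoning

  -- Since `m + 1 = k` is congruent to `v` modulo `γ`, the index is congruent to `v + p + 2`, hence
  -- to 2 modulo 4. So the second copy of `Γ` is at `2F` just before its last factor.
  node[m+[p+3]] : node (m + (p + 3)) ≡ 2F
  node[m+[p+3]] = begin
    node (m + (p + 3))
      ≡⟨ cong node (solve 2 (λ m p → m :+ (p :+ con 3) := (m :+ con 1) :+ (p :+ con 2)) refl m p) ⟩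
    node (k + (p + 2))
      ≡⟨ cong (λ n → node (n + (p + 2))) (m≡m%n+[m/n]*n k γ) ⟩
    node ((v + k ℕ./ γ * γ) + (p + 2))
      ≡⟨ cong node (solve 3 (λ v q p → v :+ q :+ (p :+ con 2) := q :+ (v :+ p :+ con 2))
                          refl v (k ℕ./ γ * γ) p) ⟩
    node (k ℕ./ γ * γ + (v + p + 2))
      ≡⟨ node-period (k ℕ./ γ) (v + p + 2) ⟩
    node (v + p + 2)
      ≡⟨ cong (λ n → node (n + 2)) v+p≡ ⟩
    node ((t₀ + 1) * γ + 2)
      ≡⟨ node-period (t₀ + 1) 2 ⟩
    2F ∎
    where
    open ≡-Reasoning
    open +-*-Solver using (solve; _:=_; _:+_; _:*_; con)

  CSR-lower : ⟦ loss 202 ⟧ ≤₋ ((Γ ⊗ S ^ p) ⊗ S ^ v ⊗ (S ^ p ⊗ Γ)) (node (3 * m)) 4F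
  CSR-lower =
    ⊗-lower {A = (Γ ⊗ S ^ p) ⊗ S ^ v} {S ^ p ⊗ Γ} {l = 3F}
      (⊗-lower {A = Γ ⊗ S ^ p} {S ^ v} {l = node (p + 3)}
        (⊗-lower {A = Γ} {S ^ p} {l = 3F} late-detour (^-lower (S-lower d) p 3))
        (subst (λ i → ⟦ 0ℚ ⟧ ≤₋ (S ^ v) (node (p + 3)) i) node[v+[p+3]]
          (^-lower (S-lower d) v (p + 3))))
      (⊗-lower {A = S ^ p} {Γ} {l = node (p + 3)}
        (^-lower (S-lower d) p 3) (late-exit (p + 3) node[m+[p+3]]))

-- Upper bounds on walks

-- Column 2F of A₁ ^ m, up to the shift q: from position a of C₄ a walk of length m
-- reaches 2F without a detour only if a + m ≡ 2 (mod 4).  For odd a + m the entry is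
-- ⊥₋ and the value here is arbitrary.
ceiling : ℚ → ℕ → ℚ
ceiling q 2 = q
ceiling q (suc (suc (suc (suc n)))) = ceiling q n
ceiling q _ = loss 300 ℚ.+ q

loss-+-≤ : ∀ q → loss 300 ℚ.+ q ℚ.≤ q
loss-+-≤ q = subst (loss 300 ℚ.+ q ℚ.≤_) (ℚ.+-identityˡ q)
  (ℚ.+-monoˡ-≤ q (from-yes (loss 300 ℚ.≤? 0ℚ)))

-- The price 300 of a detour pays for its shift by 2. The inequality is tight for `n` congruent to 2
-- modulo 4, when the rest of the walk needs no further detour.
ceiling-detour : ∀ q n → loss 300 ℚ.+ ceiling q n ℚ.≤ ceiling q (2 + n)
ceiling-detour q 0 = ℚ.≤-trans (loss-+-≤ _) (loss-+-≤ q)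
ceiling-detour q 1 = loss-+-≤ _
ceiling-detour q 2 = ℚ.≤-refl
ceiling-detour q 3 = loss-+-≤ _
ceiling-detour q (suc (suc (suc (suc n)))) = ceiling-detour q n

-- The nodes 4F and 5F enter C₄ at 3F after 2 and 1 steps.
bound : ℚ → Fin 6 → ℕ → ℚ
bound q 4F m = loss 200 ℚ.+ ceiling q (1 + m)
bound q 5F m = loss 100 ℚ.+ ceiling q (2 + m)
bound q i  m = ceiling q (toℕ i + m)

-- Equality holds along `C₄` and on the last two arcs of the detour, whose cost is built into
-- `bound`. Only on entering the detour are its three arcs weighed against the shift by 2, by
-- `ceiling-detour`.
bound-arc : ∀ q m {i l} (e : A₁ i l ≢ ⊥₋) →
            ∃[ w ] A₁ i l ≤₋ ⟦ w ⟧ × w ℚ.+ bound q l m ℚ.≤ bound q i (suc m)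
bound-arc q m {i} {l} e with edge⇒arc i l e
... | inj₁ e₁₂ = 0ℚ , ≤₋-refl , ℚ.≤-reflexive (ℚ.+-identityˡ _)
... | inj₁ e₂₃ = 0ℚ , ≤₋-refl , ℚ.≤-reflexive (ℚ.+-identityˡ _)
... | inj₁ e₃₄ = 0ℚ , ≤₋-refl , ℚ.≤-reflexive (ℚ.+-identityˡ _)
... | inj₁ e₄₁ = 0ℚ , ≤₋-refl , ℚ.≤-reflexive (ℚ.+-identityˡ _)
... | inj₂ d₃₅ = loss 100 , ≤₋-refl , ℚ.≤-trans
  (ℚ.≤-reflexive (sym (ℚ.+-assoc (loss 100) (loss 200) (ceiling q (1 + m)))))
  (ceiling-detour q (1 + m))
... | inj₂ d₅₆ = loss 100 , ≤₋-refl ,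
  ℚ.≤-reflexive (sym (ℚ.+-assoc (loss 100) (loss 100) (ceiling q (2 + m))))
... | inj₂ d₆₄ = loss 100 , ≤₋-refl , ℚ.≤-refl

fold-upper : ∀ q {X : Matrix 6} {j} → (∀ i → X i j ≤₋ ⟦ bound q i 0 ⟧) →
             ∀ m i → fold X (A₁ ⊗_) m i j ≤₋ ⟦ bound q i m ⟧
fold-upper q X≤ zero    i = X≤ i
fold-upper q {X} {j} X≤ (suc m) i = ∑-lub term≤
  where
  term≤ : ∀ l → A₁ i l ⊙ fold X (A₁ ⊗_) m l j ≤₋ ⟦ bound q i (suc m) ⟧
  term≤ l with ≡⊥? (A₁ i l)
  ... | yes eq = subst (λ a → a ⊙ fold X (A₁ ⊗_) m l j ≤₋ _) (sym eq) (⊥₋≤ _)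
  ... | no  e with bound-arc q m e
  ...   | w , a≤w , w+b≤ = ≤₋-transitive (⊙-upper a≤w (fold-upper q X≤ m l)) (⟦⟧-mono-≤ w+b≤)

-- Row and length add up to `4 * m`, which is not 2 modulo 4, so a detour is forced.
bound-early : ∀ q m → bound q (node (3 * m)) m ≡ loss 300 ℚ.+ q
bound-early q m = begin
  bound q (node (3 * m)) m ≡⟨ bound-node (3 * m) ⟩
  ceiling q (3 * m + m)    ≡⟨ cong (ceiling q) (solve 1 (λ m →
                                con 3 :* m :+ m := m :* con 4 :+ con 0) refl m) ⟩
  ceiling q (m * 4 + 0)    ≡⟨ 4∣-periodic (ceiling q) (λ _ → refl) (divides-refl m) 0 ⟩
  loss 300 ℚ.+ q           ∎
  where
  open ≡-Reasoning
  open +-*-Solver using (solve; _:=_; _:+_; _:*_; con)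
  bound-node : ∀ a → bound q (node a) m ≡ ceiling q (a + m)
  bound-node 0 = refl
  bound-node 1 = refl
  bound-node 2 = refl
  bound-node 3 = refl
  bound-node (suc (suc (suc (suc a)))) = bound-node a

-- The first `m` steps go around `C₄` and stop at `2F`; the last two factors `A₁` are kept for the
-- arcs `d₃₅` and `d₅₆`, which leaves `d₆₄` to the factor `A₂`.
fold-late-detour : ∀ {X : Matrix 6} {j q} m → ⟦ q ⟧ ≤₋ (A₁ ⊗ (A₁ ⊗ X)) 2F j →
                   ⟦ q ⟧ ≤₋ fold X (A₁ ⊗_) (m + 2) (node (3 * (m + 2))) j
fold-late-detour {X} {j} {q} m q≤ rewrite fold-+ X (A₁ ⊗_) m {2} =
  fold-lower A₁-lower m (subst (λ i → ⟦ q ⟧ ≤₋ (A₁ ⊗ (A₁ ⊗ X)) i j) (sym node≡) q≤)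
  where
  open ≡-Reasoning
  open +-*-Solver using (solve; _:=_; _:+_; _:*_; con)
  node≡ : node (m + 3 * (m + 2)) ≡ 2F
  node≡ = begin
    node (m + 3 * (m + 2))
      ≡⟨ cong node (solve 1 (λ m →
           m :+ con 3 :* (m :+ con 2) := (m :+ con 1) :* con 4 :+ con 2) refl m) ⟩
    node ((m + 1) * 4 + 2)
      ≡⟨ 4∣-periodic node (λ _ → refl) (divides-refl (m + 1)) 2 ⟩
    2F ∎

-- The products of the theorem

power-lossy : ∀ m → Lossy (m + 2) (A₁ ^ (m + 2) ⊗ A₂)
power-lossy m rewrite ^-fold A₁ (m + 2) = record
  { late-detour  = ⊗-lower {A = P} {A₂} {l = 5F} {3F} {p = loss 200} {q = loss 1}
      (fold-late-detour m [ fromℚ-mono {loss 200} ℚ.≤-refl ]) ≤₋-refl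
  ; late-exit    = λ a node≡ → ⊗-lower {A = P} {A₂} {l = 2F} {4F} {p = 0ℚ} {q = loss 1}
      (fold-lower A₁-lower (m + 2) (subst (λ (i : Fin 6) → ⟦ 0ℚ ⟧ ≤₋ I i 2F) (sym node≡) (I-lower {6} 2F)))
      ≤₋-refl
  ; early-detour = ∑-lub term≤
  }
  where
  P = fold I (A₁ ⊗_) (m + 2)
  i = node (3 * (m + 2))

  I-upper : ∀ i → I i 2F ≤₋ ⟦ bound 0ℚ i 0 ⟧
  I-upper 0F = ⊥₋≤ _
  I-upper 1F = ⊥₋≤ _
  I-upper 2F = ≤₋-refl
  I-upper 3F = ⊥₋≤ _
  I-upper 4F = ⊥₋≤ _
  I-upper 5F = ⊥₋≤ _

  absent : ∀ a → a ⊙ ⊥₋ ≤₋ ⟦ loss 301 ⟧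
  absent a = subst (_≤₋ ⟦ loss 301 ⟧) (sym (⊙-zeroʳ a)) (⊥₋≤ _)

  -- Column `4F` of `A₂` is finite only in row `2F`, with entry -1, so the power of `A₁` has to end
  -- at `2F`.
  term≤ : ∀ l → P i l ⊙ A₂ l 4F ≤₋ ⟦ loss 301 ⟧
  term≤ 0F = absent (P i 0F)
  term≤ 1F = absent (P i 1F)
  term≤ 2F = ⊙-upper {p = loss 300} {q = loss 1}
    (subst (λ b → P i 2F ≤₋ ⟦ b ⟧) (bound-early 0ℚ (m + 2)) (fold-upper 0ℚ I-upper (m + 2) i))
    ≤₋-refl
  term≤ 3F = absent (P i 3F)
  term≤ 4F = absent (P i 4F)
  term≤ 5F = absent (P i 5F)

∏-fold : ∀ m → ∏ A₁,₂ (replicate m 0F ++ 1F ∷ []) ≡ fold (A₂ ⊗ I) (A₁ ⊗_) m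
∏-fold zero    = refl
∏-fold (suc m) = cong (A₁ ⊗_) (∏-fold m)

-- A word product nests to the right and ends in `A₂ ⊗ I`, so `A₂` enters through the initial matrix
-- of the fold. The shift of `ceiling` is therefore -1, the weight of the exit edge in `A₂`.
word-lossy : ∀ m → Lossy (m + 2) (∏ A₁,₂ (replicate (m + 2) 0F ++ 1F ∷ []))
word-lossy m rewrite ∏-fold (m + 2) = record
  { late-detour  = fold-late-detour m [ fromℚ-mono {loss 201} ℚ.≤-refl ]
  ; late-exit    = λ a node≡ → fold-lower A₁-lower (m + 2)
      (subst (λ i → ⟦ loss 1 ⟧ ≤₋ (A₂ ⊗ I) i 4F) (sym node≡) [ fromℚ-mono {loss 1} ℚ.≤-refl ])
  ; early-detour = subst (λ b → fold (A₂ ⊗ I) (A₁ ⊗_) (m + 2) (node (3 * (m + 2))) 4F ≤₋ ⟦ b ⟧)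
      (bound-early (loss 1) (m + 2)) (fold-upper (loss 1) A₂⊗I-upper (m + 2) _)
  }
  where
  A₂⊗I-upper : ∀ i → (A₂ ⊗ I) i 4F ≤₋ ⟦ bound (loss 1) i 0 ⟧
  A₂⊗I-upper 0F = ⊥₋≤ _
  A₂⊗I-upper 1F = ⊥₋≤ _
  A₂⊗I-upper 2F = [ fromℚ-mono {loss 1} ℚ.≤-refl ]
  A₂⊗I-upper 3F = ⊥₋≤ _
  A₂⊗I-upper 4F = ⊥₋≤ _
  A₂⊗I-upper 5F = ⊥₋≤ _

-- The bound `2 ≤ m` provides the two factors `A₁` that carry the first two arcs of the late detour.
power-¬CSR : (d : CSRData A₁,₂) → ∀ m → 2 ≤ m → ¬ IsCSR d (m + 1) (A₁ ^ m ⊗ A₂)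
power-¬CSR d m 2≤m = subst (λ m → ¬ IsCSR d (m + 1) (A₁ ^ m ⊗ A₂)) (ℕ.m∸n+n≡m 2≤m)
  (lossy⇒¬CSR d (m ℕ.∸ 2 + 2) (power-lossy (m ℕ.∸ 2)))

mainTheorem5 : (digraph A₁ ≋ digraph A₂ × HasCyclicity (digraph A₁) 2)
    × (criticalDigraph A₁ ≋ C₄ × criticalDigraph A₂ ≋ C₄ × HasCyclicity C₄ 4)
    × CSRData A₁,₂
    × ((d : CSRData A₁,₂) →
    (∀ t → 2 ≤ t →
    ¬ IsCSR d (4 * t + 1) (A₁ ^ (4 * t) ⊗ A₂)
    × ¬ IsCSR d (4 * t + 2) (A₁ ^ (4 * t + 1) ⊗ A₂)
    × ¬ IsCSR d (4 * t + 3) (A₁ ^ (4 * t + 2) ⊗ A₂)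
    × ¬ IsCSR d (4 * t + 4) (A₁ ^ (4 * t + 3) ⊗ A₂))
    × (∀ N → ∃[ k ] N ≤ k × (Σ[ w ∈ Vec (Fin 2) k ] ¬ IsCSR d k (∏ A₁,₂ w))))
mainTheorem5 =
  (example-digraphs _ _ , example-cyclicity) ,
  (A₁,₂-critical 0F , A₁,₂-critical 1F , C₄-cyclicity) ,
  A₁,₂-CSRData ,
  λ d →
    (λ t 2≤t →
      let 2≤4t = ℕ.≤-trans 2≤t (ℕ.m≤n*m t 4)
          ¬CSR = λ r → subst (λ k → ¬ IsCSR d k (A₁ ^ (4 * t + r) ⊗ A₂)) (ℕ.+-assoc (4 * t) r 1)
                         (power-¬CSR d (4 * t + r) (ℕ.≤-trans 2≤4t (ℕ.m≤m+n (4 * t) r)))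
      in power-¬CSR d (4 * t) 2≤4t , ¬CSR 1 , ¬CSR 2 , ¬CSR 3) ,
    -- The word consists of `N + 2` letters for `A₁` followed by one for `A₂`.
    λ N → N + 2 + 1 , ℕ.≤-trans (ℕ.m≤m+n N 2) (ℕ.m≤m+n (N + 2) 1) ,
      replicate (N + 2) 0F ++ 1F ∷ [] , lossy⇒¬CSR d (N + 2) (word-lossy N)
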